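{- Fix $D>0$ and the two-point line $X=\{0,D\}$ with $d(0,D)=D$ and initial server position $0$. Under either elective or automatic service, every deterministic visible online algorithm has competitive ratio at least $3$. More precisely, for every such algorithm and every $\rho<3$ there is a finite input $I$ with $\operatorname{ALG}(I)>\rho\operatorname{OPT}(I)$. The conclusion also survives a fixed additive constant in the definition of competitiveness: for every such algorithm, every $\rho<3$ and every constant $\beta$, there is a finite input $I$ with $\operatorname{ALG}(I)>\rho\operatorname{OPT}(I)+\beta$.
   Context: Model. $(X,d)$ is a finite metric space with an initial server position $s_0\in X$. An input $I$ is a finite set of request occurrences; each request $q$ has an arrival time $a(q)\ge 0$ and a location $x(q)\in X$. An arrival epoch is the set of all requests sharing one arrival time. A walk $P=(v_0,\ldots,v_\ell)$ in $X$ ($\ell\ge 0$) is executed instantaneously at one time, visits its listed vertices, and has length $\operatorname{len}(P)=\sum_{i}d(v_{i-1},v_i)$. A schedule is a finite sequence of atomic actions with nondecreasing timestamps. At time $t$ the complete epoch arriving at $t$ is processed first; then one action at $t$ performs a finite ordered sequence of walks, and no further arrival is processed until the action ends. The first walk starts at $s_0$ and every later one starts where its predecessor ended. A walk $P$ at time $t$ during which a nonempty set $B$ of pending requests is served is one service event of cost $\operatorname{len}(P)+\max_{q\in B}(t-a(q))$; a walk serving no request costs $\operatorname{len}(P)$. The cost of a schedule is the sum of these costs. Every request must eventually be served. Elective service: a pending request may be included in $B$ only if its location is visited by $P$, but the server may visit or occupy a location without serving the requests there. Automatic service: every pending request whose location is visited by a walk is served in that event, and a request arriving at the current server position is served immediately.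 Visible: an online algorithm learns each request, including its location, at its arrival time and has no information about future requests. $\operatorname{ALG}(I)$ is the cost of the algorithm on $I$, and $\operatorname{OPT}(I)$ is the infimum of costs of feasible clairvoyant schedules under the same service semantics. An algorithm is $\rho$-competitive if $\operatorname{ALG}(I)\le\rho\operatorname{OPT}(I)$ for every finite input $I$; online algorithms are required to serve all requests of every finite input. -}

module Defs where

open import Algebra.Bundles using (CommutativeRing)
open import Algebra.Construct.NaturalChoice.Max as Max using ()
open import Data.Empty using (⊥; ⊥-elim)
open import Data.Fin using (Fin; zero; suc)
open import Data.List using (List; []; _∷_; filter; foldl; foldr; map)
open import Data.List.Membership.Propositional using (_∈_; _∉_)
open import Data.List.NonEmpty as List⁺ using (List⁺; _∷_)
open import Data.List.Relation.Unary.All using (All)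
open import Data.List.Relation.Unary.Linked using (Linked)
open import Data.List.Relation.Unary.Unique.Propositional using (Unique)
open import Data.Nat using (ℕ)
open import Data.Product using (_×_; _,_; ∃-syntax)
open import Data.Sum using (_⊎_; inj₁; inj₂)
open import Data.Unit using (⊤)
open import Function using (_⇔_)
open import Function.Metric.Structures using (IsGeneralMetric)
open import Level using (0ℓ)
open import Relation.Binary.Bundles using (TotalOrder)
open import Relation.Binary.Core using (Rel)
open import Relation.Binary.PropositionalEquality as ≡ using (_≡_; _≢_)
open import Relation.Binary.Structures using (IsStrictTotalOrder; IsDecTotalOrder)
open import Relation.Nullary using (¬_)
open import Relation.Unary using (Pred)
import Relation.Binary.Construct.StrictToNonStrict as StrictToNonStrict

-- The real numbers, up to isomorphism: ordered fields with the
-- infimum property.  Both the trichotomy of the order and the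
-- existence of infima are to be read classically.
record CompleteOrderedField : Set₁ where
  infix 4 _<_
  field
    commutativeRing : CommutativeRing 0ℓ 0ℓ

  open CommutativeRing commutativeRing public hiding (zero)

  field
    _<_                : Rel Carrier 0ℓ
    isStrictTotalOrder : IsStrictTotalOrder _≈_ _<_
    0<1                : 0# < 1#
    +-monoˡ-<          : ∀ {x y} z → x < y → x + z < y + z
    *-pos              : ∀ {x y} → 0# < x → 0# < y → 0# < x * y
    inverse            : ∀ x → ¬ (x ≈ 0#) → ∃[ y ] x * y ≈ 1#

  open StrictToNonStrict _≈_ _<_ public using (_≤_)
  open IsStrictTotalOrder isStrictTotalOrder public
    using (compare; _≟_; _<?_)

  ≤-isDecTotalOrder : IsDecTotalOrder _≈_ _≤_
  ≤-isDecTotalOrder = StrictToNonStrict.isDecTotalOrder _≈_ _<_ isStrictTotalOrder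

  open IsDecTotalOrder ≤-isDecTotalOrder public using (_≤?_)

  ≤-totalOrder : TotalOrder 0ℓ 0ℓ 0ℓ
  ≤-totalOrder = record
    { isTotalOrder = IsDecTotalOrder.isTotalOrder ≤-isDecTotalOrder }

  open Max ≤-totalOrder public using (_⊔_)

  IsLowerBound : Pred Carrier 0ℓ → Carrier → Set
  IsLowerBound P m = ∀ {x} → P x → m ≤ x

  IsInfimum : Pred Carrier 0ℓ → Carrier → Set
  IsInfimum P m = IsLowerBound P m × (∀ y → m < y → ∃[ x ] P x × x < y)

  field
    infimum : ∀ (P : Pred Carrier 0ℓ) → (∃[ x ] P x) →
              (∃[ b ] IsLowerBound P b) → ∃[ m ] IsInfimum P m

  3# : Carrier
  3# = 1# + 1# + 1#

record FiniteMetricSpace (ℝ : CompleteOrderedField) : Set where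
  open CompleteOrderedField ℝ
  field
    size     : ℕ
    d        : Fin size → Fin size → Carrier
    isMetric : IsGeneralMetric _≡_ _≈_ _≤_ 0# _+_ d

  Point : Set
  Point = Fin size

-- The two-point line {0 , D}: `zero` is the point 0, `suc zero` is the point D.
module _ (ℝ : CompleteOrderedField) where
  open CompleteOrderedField ℝ

  twoPointLine : (D : Carrier) → 0# < D → FiniteMetricSpace ℝ
  twoPointLine D 0<D = record
    { size     = 2
    ; d        = dist
    ; isMetric = record
      { isSemiMetric = record
        { isQuasiSemiMetric = record
          { isPreMetric = record
            { isProtoMetric = record
              { isPartialOrder  = IsDecTotalOrder.isPartialOrder ≤-isDecTotalOrder
              ; ≈-isEquivalence = ≡.isEquivalence
              ; cong            = λ { ≡.refl ≡.refl → refl }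
              ; nonNegative     = λ {p} {q} → nonNegative p q
              }
            ; ≈⇒0 = λ { {p} ≡.refl → dist-self p }
            }
          ; 0⇒≈ = λ {p} {q} → indiscernible p q
          }
        ; sym = dist-sym
        }
      ; triangle = triangle
      }
    }
    where
    dist : Fin 2 → Fin 2 → Carrier
    dist zero       zero       = 0#
    dist zero       (suc zero) = D
    dist (suc zero) zero       = D
    dist (suc zero) (suc zero) = 0#

    nonNegative : ∀ p q → 0# ≤ dist p q
    nonNegative zero       zero       = inj₂ refl
    nonNegative zero       (suc zero) = inj₁ 0<D
    nonNegative (suc zero) zero       = inj₁ 0<D
    nonNegative (suc zero) (suc zero) = inj₂ refl

    dist-self : ∀ p → dist p p ≈ 0#
    dist-self zero       = refl
    dist-self (suc zero) = refl

    D≉0 : ¬ (D ≈ 0#)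
    D≉0 D≈0 = IsStrictTotalOrder.irrefl isStrictTotalOrder (sym D≈0) 0<D

    indiscernible : ∀ p q → dist p q ≈ 0# → p ≡ q
    indiscernible zero       zero       _   = ≡.refl
    indiscernible zero       (suc zero) D≈0 = ⊥-elim (D≉0 D≈0)
    indiscernible (suc zero) zero       D≈0 = ⊥-elim (D≉0 D≈0)
    indiscernible (suc zero) (suc zero) _   = ≡.refl

    dist-sym : ∀ p q → dist p q ≈ dist q p
    dist-sym zero       zero       = refl
    dist-sym zero       (suc zero) = refl
    dist-sym (suc zero) zero       = refl
    dist-sym (suc zero) (suc zero) = refl

    0<D+D : 0# < D + D
    0<D+D = IsStrictTotalOrder.trans isStrictTotalOrder 0<D
      (IsStrictTotalOrder.<-respˡ-≈ isStrictTotalOrder (+-identityˡ D) (+-monoˡ-< D 0<D))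

    triangle : ∀ p q r → dist p r ≤ dist p q + dist q r
    triangle zero       zero       zero       = inj₂ (sym (+-identityˡ 0#))
    triangle zero       zero       (suc zero) = inj₂ (sym (+-identityˡ D))
    triangle zero       (suc zero) zero       = inj₁ 0<D+D
    triangle zero       (suc zero) (suc zero) = inj₂ (sym (+-identityʳ D))
    triangle (suc zero) zero       zero       = inj₂ (sym (+-identityʳ D))
    triangle (suc zero) zero       (suc zero) = inj₁ 0<D+D
    triangle (suc zero) (suc zero) zero       = inj₂ (sym (+-identityˡ D))
    triangle (suc zero) (suc zero) (suc zero) = inj₂ (sym (+-identityˡ 0#))

data Service : Set where
  elective automatic : Service

module Model (ℝ : CompleteOrderedField) (X : FiniteMetricSpace ℝ)
             (s₀ : FiniteMetricSpace.Point X) where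
  open CompleteOrderedField ℝ
  open FiniteMetricSpace X

  -- The label only tells apart occurrences with equal arrival and location.
  record Request : Set where
    constructor request
    field
      label    : ℕ
      arrival  : Carrier
      location : Point
  open Request public

  record Input : Set where
    field
      requests     : List Request
      distinct     : Unique (map label requests)
      arrivals-≥0  : All (λ q → 0# ≤ arrival q) requests
  open Input public

  Walk : Set
  Walk = List⁺ Point

  len : Walk → Carrier
  len (v ∷ vs) = go v vs
    where
    go : Point → List Point → Carrier
    go v []       = 0#
    go v (w ∷ ws) = d v w + go w ws

  -- A walk together with the set B of requests served during it;
  -- B empty means that the walk is not a service event.
  record Step : Set where
    constructor step
    field
      walk   : Walk
      served : List Request
  open Step public

  record Action : Set where
    constructor action
    field
      time  : Carrier
      steps : List Step
  open Action public

  Schedule : Set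
  Schedule = List Action

  maxDelay : Carrier → List⁺ Request → Carrier
  maxDelay t B = List⁺.foldr₁ _⊔_ (List⁺.map (λ q → t - arrival q) B)

  stepCost : Carrier → Step → Carrier
  stepCost t (step P [])      = len P
  stepCost t (step P (q ∷ B)) = len P + maxDelay t (q ∷ B)

  sum : List Carrier → Carrier
  sum = foldr _+_ 0#

  actionCost : Action → Carrier
  actionCost (action t es) = sum (map (stepCost t) es)

  cost : Schedule → Carrier
  cost S = sum (map actionCost S)

  record State : Set₁ where
    field
      position : Point
      pending  : Pred Request 0ℓ
      upcoming : Pred Request 0ℓ
  open State public

  initial : Input → State
  initial I = record
    { position = s₀
    ; pending  = λ _ → ⊥
    ; upcoming = λ q → q ∈ requests I
    }

  -- Whether a request arriving while the server is at p becomes pending.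
  -- Under automatic service a request arriving at p is served at once, with
  -- zero delay and no movement, so it adds nothing to the cost.
  BecomesPending : Service → Point → Request → Set
  BecomesPending elective  p q = ⊤
  BecomesPending automatic p q = location q ≢ p

  -- Process all epochs up to and including time t.  The server does not move
  -- between two actions, so these epochs all find it at the same position.
  advance : Service → Carrier → State → State
  advance mode t s = record
    { position = position s
    ; pending  = λ q → pending s q ⊎
                   (upcoming s q × arrival q ≤ t × BecomesPending mode (position s) q)
    ; upcoming = λ q → upcoming s q × t < arrival q
    }

  Servable : State → Walk → Pred Request 0ℓ
  Servable s P q = pending s q × location q ∈ List⁺.toList P

  LegalService : Service → State → Step → Set
  LegalService elective  s e = ∀ q → q ∈ served e → Servable s (walk e) q
  LegalService automatic s e = ∀ q → q ∈ served e ⇔ Servable s (walk e) q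

  LegalStep : Service → State → Step → Set
  LegalStep mode s e = List⁺.head (walk e) ≡ position s × LegalService mode s e

  execute : State → Step → State
  execute s e = record
    { position = List⁺.last (walk e)
    ; pending  = λ q → pending s q × q ∉ served e
    ; upcoming = upcoming s
    }

  LegalSteps : Service → State → List Step → Set
  LegalSteps mode s []       = ⊤
  LegalSteps mode s (e ∷ es) = LegalStep mode s e × LegalSteps mode (execute s e) es

  -- Legality of the remaining actions from state s, including that every
  -- request is eventually served.  A request arriving after the last action
  -- can only be served by the arrival rule of automatic service.
  LegalFrom : Service → State → Schedule → Set
  LegalFrom mode s [] =
    ∀ q → ¬ (pending s q ⊎ (upcoming s q × BecomesPending mode (position s) q))
  LegalFrom mode s (action t es ∷ S) =
    LegalSteps mode s′ es × LegalFrom mode (foldl execute s′ es) S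
    where s′ = advance mode t s

  record Feasible (mode : Service) (I : Input) (S : Schedule) : Set where
    field
      times-≥0     : All (λ a → 0# ≤ time a) S
      times-sorted : Linked (λ a b → time a ≤ time b) S
      legal        : LegalFrom mode (initial I) S

  requestsUpTo : Carrier → Input → List Request
  requestsUpTo t I = filter (λ q → arrival q ≤? t) (requests I)

  actionsUpTo : Carrier → Schedule → Schedule
  actionsUpTo t = filter (λ a → time a ≤? t)

  -- `causal` is the absence of information about the future: what is done up
  -- to time t is determined by the requests that have arrived up to time t.
  record OnlineAlgorithm (mode : Service) : Set where
    field
      run      : Input → Schedule
      feasible : ∀ I → Feasible mode I (run I)
      causal   : ∀ I I′ t → requestsUpTo t I ≡ requestsUpTo t I′ →
                 actionsUpTo t (run I) ≡ actionsUpTo t (run I′)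

    ALG : Input → Carrier
    ALG I = cost (run I)

  FeasibleCost : Service → Input → Pred Carrier 0ℓ
  FeasibleCost mode I c = ∃[ S ] Feasible mode I S × c ≈ cost S

  IsOPT : Service → Input → Carrier → Set
  IsOPT mode I = IsInfimum (FeasibleCost mode I)

  module _ {mode : Service} (A : OnlineAlgorithm mode) where
    open OnlineAlgorithm A

    Competitive : Carrier → Set
    Competitive ρ = ∀ I opt → IsOPT mode I opt → ALG I ≤ ρ * opt

{-# OPTIONS --safe #-}

-- The adversary requests D, 0, D, 0, …, each request coming δ after the
-- previous one has been served.  If the i-th request waits for xᵢ, the
-- algorithm pays D + xᵢ for it: it has to cross the line between two
-- services, and no two requests share a service event.  A clairvoyant server
-- can handle three consecutive requests for D + xᵢ + δ: it lets the first
-- wait, stays where it is until the second has arrived there, and then moves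
-- to serve the first, arriving in time for the third.  Serving the first 0, 1
-- or 2 requests greedily shifts the indices i that are charged, so the three
-- resulting schedules together cost at most ALG + nδ + 3D, which gives
-- 3 OPT ≤ ALG + nδ + 3D while ALG ≥ nD - nδ is unbounded.
module Submission where

open import Defs
open import Algebra.Construct.NaturalChoice.Max as Max using ()
open import Algebra.Construct.NaturalChoice.MaxOp as MaxOp using ()
open import Algebra.Properties.CommutativeMonoid.Mult as CommutativeMonoidMult using ()
open import Algebra.Properties.Semiring.Mult as SemiringMult using ()
open import Algebra.Solver.Ring.NaturalCoefficients.Default as NaturalCoefficients using ()
open import Data.Fin as Fin using (zero; suc)
open import Data.List using (List; []; _∷_; _++_; _∷ʳ_; _∷ʳ′_; drop; foldl; initLast; length; map)
open import Data.List.Membership.Propositional using (_∈_; _∉_)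
open import Data.List.Membership.Propositional.Properties using (∈-++⁺ʳ)
open import Data.List.NonEmpty as List⁺ using (_∷_)
open import Data.List.Properties using (++-identityʳ; filter-++; filter-accept; filter-none; filter-reject; length-++; map-++)
open import Data.List.Relation.Unary.All as All using (All; []; _∷_)
open import Data.List.Relation.Unary.All.Properties as All using ()
open import Data.List.Relation.Unary.AllPairs as AllPairs using (AllPairs; []; _∷_)
open import Data.List.Relation.Unary.AllPairs.Properties as AllPairs using ()
open import Data.List.Relation.Unary.Any using (here; there)
open import Data.List.Relation.Unary.Linked using (Linked; []; [-]; _∷_)
open import Data.Nat as ℕ using (ℕ)
open import Data.Nat.Properties as ℕ using ()
open import Data.Product using (_×_; _,_; ∃-syntax; proj₁; proj₂)
open import Data.Sum using (_⊎_; inj₁; inj₂)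
open import Data.Unit using (⊤; tt)
open import Function using (_⇔_; mk⇔; Equivalence)
open import Function.Metric.Structures using (IsGeneralMetric)
open import Level using (0ℓ)
open import Relation.Binary.Bundles using (StrictPartialOrder)
open import Relation.Binary.Definitions using (tri<; tri≈; tri>)
open import Relation.Binary.PropositionalEquality as ≡ using (_≡_; _≢_)
open import Relation.Binary.Reasoning.StrictPartialOrder as StrictReasoning using ()
open import Relation.Binary.Structures using (IsStrictTotalOrder; IsDecTotalOrder)
open import Relation.Nullary using (¬_; Dec; yes; no; contradiction)

-- Order and arithmetic in a complete ordered field, with the classical consequences of infima.

module CompleteOrderedFieldProperties (ℝ : CompleteOrderedField) where
  open CompleteOrderedField ℝ
  open SemiringMult semiring public using (×-comm-*; ×-congʳ) renaming (_×_ to _·_)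
  open NaturalCoefficients commutativeSemiring public using (solve; _:=_; _:+_; _:*_; con)

  private
    module < = IsStrictTotalOrder isStrictTotalOrder
    module ≤ = IsDecTotalOrder ≤-isDecTotalOrder

  <-strictPartialOrder : StrictPartialOrder 0ℓ 0ℓ 0ℓ
  <-strictPartialOrder = record { isStrictPartialOrder = <.isStrictPartialOrder }

  module Reasoning = StrictReasoning <-strictPartialOrder
  open Reasoning

  ≤-refl : ∀ {x} → x ≤ x
  ≤-refl = ≤.refl

  ≤-trans : ∀ {x y z} → x ≤ y → y ≤ z → x ≤ z
  ≤-trans = ≤.trans

  <-≤-trans : ∀ {x y z} → x < y → y ≤ z → x < z
  <-≤-trans {x} {y} {z} x<y y≤z = begin-strict x <⟨ x<y ⟩ y ≤⟨ y≤z ⟩ z ∎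

  ≤-<-trans : ∀ {x y z} → x ≤ y → y < z → x < z
  ≤-<-trans {x} {y} {z} x≤y y<z = begin-strict x ≤⟨ x≤y ⟩ y <⟨ y<z ⟩ z ∎

  ≤⇒≯ : ∀ {x y} → x ≤ y → ¬ (y < x)
  ≤⇒≯ x≤y y<x = <.irrefl refl (≤-<-trans x≤y y<x)

  ≮⇒≥ : ∀ {x y} → ¬ (x < y) → y ≤ x
  ≮⇒≥ {x} {y} x≮y with compare x y
  ... | tri< x<y _ _ = contradiction x<y x≮y
  ... | tri≈ _ x≈y _ = inj₂ (sym x≈y)
  ... | tri> _ _ y<x = inj₁ y<x

  ≰⇒> : ∀ {x y} → ¬ (x ≤ y) → y < x
  ≰⇒> {x} {y} x≰y with compare x y
  ... | tri< x<y _ _ = contradiction (inj₁ x<y) x≰y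
  ... | tri≈ _ x≈y _ = contradiction (inj₂ x≈y) x≰y
  ... | tri> _ _ y<x = y<x

  +-monoˡ-≤ : ∀ z {x y} → x ≤ y → x + z ≤ y + z
  +-monoˡ-≤ z (inj₁ x<y) = inj₁ (+-monoˡ-< z x<y)
  +-monoˡ-≤ z (inj₂ x≈y) = inj₂ (+-congʳ x≈y)

  infixr 6 _+-≤_ _+-<-≤_

  _+-≤_ : ∀ {w x y z} → w ≤ x → y ≤ z → w + y ≤ x + z
  _+-≤_ {w} {x} {y} {z} w≤x y≤z = begin
    w + y ≤⟨ +-monoˡ-≤ y w≤x ⟩
    x + y ≈⟨ +-comm x y ⟩
    y + x ≤⟨ +-monoˡ-≤ x y≤z ⟩
    z + x ≈⟨ +-comm z x ⟩
    x + z ∎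

  _+-<-≤_ : ∀ {w x y z} → w < x → y ≤ z → w + y < x + z
  _+-<-≤_ {w} {x} {y} {z} w<x y≤z = begin-strict
    w + y <⟨ +-monoˡ-< y w<x ⟩
    x + y ≤⟨ ≤-refl +-≤ y≤z ⟩
    x + z ∎

  +-cancelʳ-≤ : ∀ z {x y} → x + z ≤ y + z → x ≤ y
  +-cancelʳ-≤ z x+z≤y+z = ≮⇒≥ λ y<x → ≤⇒≯ x+z≤y+z (+-monoˡ-< z y<x)

  +-cancelʳ-< : ∀ z {x y} → x + z < y + z → x < y
  +-cancelʳ-< z x+z<y+z = ≰⇒> λ y≤x → ≤⇒≯ (+-monoˡ-≤ z y≤x) x+z<y+z

  -- x ≤ y as a consequence of a ≤ b, where a ≤ b is a sum of known
  -- inequalities: y - x ≈ b - a with both sides moved so that no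
  -- subtraction occurs.
  ≤-from : ∀ {a b x y} → a ≤ b → x + b ≈ y + a → x ≤ y
  ≤-from {a} {b} {x} {y} a≤b x+b≈y+a = +-cancelʳ-≤ a (begin
    x + a ≤⟨ ≤-refl +-≤ a≤b ⟩
    x + b ≈⟨ x+b≈y+a ⟩
    y + a ∎)

  <-from : ∀ {a b x y} → a < b → x + b ≈ y + a → x < y
  <-from {a} {b} {x} {y} a<b x+b≈y+a = +-cancelʳ-< a (begin-strict
    x + a ≈⟨ +-comm x a ⟩
    a + x <⟨ +-monoˡ-< x a<b ⟩
    b + x ≈⟨ +-comm b x ⟩
    x + b ≈⟨ x+b≈y+a ⟩
    y + a ∎)

  x+[y-x]≈y : ∀ x y → x + (y - x) ≈ y
  x+[y-x]≈y x y = trans (+-congˡ (+-comm y (- x)))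
    (trans (sym (+-assoc x (- x) y)) (trans (+-congʳ (-‿inverseʳ x)) (+-identityˡ y)))

  x≤y⇒0≤y-x : ∀ {x y} → x ≤ y → 0# ≤ y - x
  x≤y⇒0≤y-x {x} {y} x≤y = +-cancelʳ-≤ x (begin
    0# + x      ≈⟨ +-identityˡ x ⟩
    x           ≤⟨ x≤y ⟩
    y           ≈⟨ x+[y-x]≈y x y ⟨
    x + (y - x) ≈⟨ +-comm x (y - x) ⟩
    y - x + x   ∎)

  x<y⇒0<y-x : ∀ {x y} → x < y → 0# < y - x
  x<y⇒0<y-x {x} {y} x<y = +-cancelʳ-< x (begin-strict
    0# + x      ≈⟨ +-identityˡ x ⟩
    x           <⟨ x<y ⟩
    y           ≈⟨ x+[y-x]≈y x y ⟨
    x + (y - x) ≈⟨ +-comm x (y - x) ⟩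
    y - x + x   ∎)

  *-monoˡ-< : ∀ {x y z} → 0# < x → y < z → x * y < x * z
  *-monoˡ-< {x} {y} {z} 0<x y<z = begin-strict
    x * y               ≈⟨ +-identityˡ (x * y) ⟨
    0# + x * y          <⟨ +-monoˡ-< (x * y) (*-pos 0<x (x<y⇒0<y-x y<z)) ⟩
    x * (z - y) + x * y ≈⟨ distribˡ x (z - y) y ⟨
    x * (z - y + y)     ≈⟨ *-congˡ (trans (+-comm (z - y) y) (x+[y-x]≈y y z)) ⟩
    x * z               ∎

  *-monoˡ-≤ : ∀ {x y z} → 0# ≤ x → y ≤ z → x * y ≤ x * z
  *-monoˡ-≤ (inj₁ 0<x) (inj₁ y<z) = inj₁ (*-monoˡ-< 0<x y<z)
  *-monoˡ-≤ {x} (inj₁ 0<x) (inj₂ y≈z) = inj₂ (*-congˡ y≈z)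
  *-monoˡ-≤ {x} {y} {z} (inj₂ 0≈x) _ = inj₂ (begin-equality
    x * y  ≈⟨ *-congʳ 0≈x ⟨
    0# * y ≈⟨ zeroˡ y ⟩
    0#     ≈⟨ zeroˡ z ⟨
    0# * z ≈⟨ *-congʳ 0≈x ⟩
    x * z  ∎)

  0<1+1 : 0# < 1# + 1#
  0<1+1 = <.trans 0<1 (<.<-respˡ-≈ (+-identityˡ 1#) (+-monoˡ-< 1# 0<1))

  0<3# : 0# < 3#
  0<3# = <-from (0<1 +-<-≤ inj₁ 0<1 +-≤ inj₁ 0<1)
    (solve 1 (λ o → con 0 :+ (o :+ (o :+ o)) := o :+ o :+ o :+ (con 0 :+ (con 0 :+ con 0))) refl 1#)

  half : ∀ {x} → 0# < x → ∃[ h ] 0# < h × h + h ≈ x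
  half {x} 0<x with inverse (1# + 1#) (λ eq → <.irrefl (sym eq) 0<1+1)
  ... | y , 2y≈1 = y * x , *-pos 0<y 0<x , (begin-equality
    y * x + y * x     ≈⟨ solve 2 (λ x y → y :* x :+ y :* x := (con 1 :+ con 1) :* y :* x) refl x y ⟩
    (1# + 1#) * y * x ≈⟨ *-congʳ 2y≈1 ⟩
    1# * x            ≈⟨ *-identityˡ x ⟩
    x                 ∎)
    where
    0<y : 0# < y
    0<y = ≰⇒> λ y≤0 → ≤⇒≯ (*-monoˡ-≤ (inj₁ 0<1+1) y≤0)
      (<.<-respʳ-≈ (sym 2y≈1) (<.<-respˡ-≈ (sym (zeroʳ (1# + 1#))) 0<1))

  -- The infimum of { 1 } ∪ { 0 ∣ P } is below 1 precisely when P holds.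
  excludedMiddle : (P : Set) → Dec P
  excludedMiddle P with infimum Q (1# , inj₁ refl) (0# , 0-lower)
    where
    Q : Carrier → Set
    Q x = x ≈ 1# ⊎ (x ≈ 0# × P)
    0-lower : IsLowerBound Q 0#
    0-lower (inj₁ x≈1)       = inj₁ (<.<-respʳ-≈ (sym x≈1) 0<1)
    0-lower (inj₂ (x≈0 , _)) = inj₂ (sym x≈0)
  ... | m , lower , approached with m <? 1#
  ...   | no  m≮1 = no λ p → ≤⇒≯ (lower (inj₂ (refl , p))) (<-≤-trans 0<1 (≮⇒≥ m≮1))
  ...   | yes m<1 with approached 1# m<1
  ...     | x , inj₁ x≈1 , x<1     = contradiction x<1 (<.irrefl x≈1)
  ...     | x , inj₂ (_ , p) , x<1 = yes p

  -- If no multiple of `x` exceeds `y`, the negated multiples have an infimum `m`; some `- (n · x)`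
  -- lies below `m + x`, and then the next one lies below `m`. The witness `n` is not computed, so
  -- the case split is classical.
  archimedean : ∀ {x} → 0# < x → ∀ y → ∃[ n ] y < n · x
  archimedean {x} 0<x y with excludedMiddle (∃[ n ] y < n · x)
  ... | yes found = found
  ... | no  none with infimum Q (_ , 0 , refl) (- y , -y-lower)
    where
    Q : Carrier → Set
    Q z = ∃[ n ] z ≈ - (n · x)
    -y-lower : IsLowerBound Q (- y)
    -y-lower {z} (n , z≈-nx) = ≤-from {n · x} {y} (≮⇒≥ λ y<nx → none (n , y<nx)) (begin-equality
      - y + y          ≈⟨ -‿inverseˡ y ⟩
      0#               ≈⟨ -‿inverseˡ (n · x) ⟨
      - (n · x) + n · x ≈⟨ +-congʳ z≈-nx ⟨
      z + n · x        ∎)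
  ...   | m , lower , approached with approached (m + x)
           (<-from 0<x (sym (+-identityʳ (m + x))))
  ...     | z , (n , z≈-nx) , z<m+x = contradiction z<m+x (≤⇒≯
    (≤-from (lower (ℕ.suc n , refl)) (begin-equality
      m + x + - (x + n · x)                ≈⟨ +-congʳ (+-congˡ (+-identityʳ x)) ⟨
      m + (x + 0#) + - (x + n · x)         ≈⟨ +-congʳ (+-congˡ (+-congˡ (-‿inverseʳ (n · x)))) ⟨
      m + (x + (n · x + - (n · x))) + - (x + n · x)
        ≈⟨ solve 5 (λ m x y v w → m :+ (x :+ (y :+ v)) :+ w := v :+ m :+ (x :+ y :+ w)) refl
             m x (n · x) (- (n · x)) (- (x + n · x)) ⟩
      - (n · x) + m + (x + n · x + - (x + n · x)) ≈⟨ +-congˡ (-‿inverseʳ (x + n · x)) ⟩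
      - (n · x) + m + 0#                   ≈⟨ +-identityʳ _ ⟩
      - (n · x) + m                        ≈⟨ +-congʳ z≈-nx ⟨
      z + m                                ∎)))

  -- Three times the conclusion is the sum of the fourth hypothesis times ρ,
  -- the fifth times g, and the last.
  combineBounds : ∀ {ρ g o a β N m k} → 0# ≤ ρ → 0# < g → ρ + g ≈ 3# →
                  o + (o + o) ≤ k + (a + N) → m ≤ a + N → N + N + (N + N) ≈ g * m →
                  ρ * k + (β + (β + β)) < N → ρ * o + β < a
  combineBounds {ρ} {g} {o} {a} {β} {N} {m} {k} 0≤ρ 0<g ρ+g≈3 o≤ m≤ 4N≈gm large =
    ≰⇒> λ a≤ → ≤⇒≯ (a≤ +-≤ a≤ +-≤ a≤) tripled
    where
    x = ρ * o + β

    tripled : x + (x + x) < a + (a + a)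
    tripled = <-from
      (large +-<-≤ *-monoˡ-≤ 0≤ρ o≤ +-≤ *-monoˡ-≤ (inj₁ 0<g) m≤ +-≤ inj₂ 4N≈gm
             +-≤ inj₂ (*-congʳ {a + N} ρ+g≈3))
      (solve 8 (λ ρ o β a N g k m →
          let x = ρ :* o :+ β
              b = a :+ N
          in x :+ (x :+ x)
               :+ (N :+ (ρ :* (k :+ b) :+ (g :* b :+ (g :* m :+ (con 1 :+ con 1 :+ con 1) :* b))))
             := a :+ (a :+ a)
               :+ (ρ :* k :+ (β :+ (β :+ β)) :+ (ρ :* (o :+ (o :+ o)) :+ (g :* m
                    :+ (N :+ N :+ (N :+ N) :+ (ρ :+ g) :* b)))))
        refl ρ o β a N g k m)

-- Lower bounds on the cost of legal schedules in an arbitrary finite metric space.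

module ModelProperties (ℝ : CompleteOrderedField) (X : FiniteMetricSpace ℝ)
                       (s₀ : FiniteMetricSpace.Point X) where
  open CompleteOrderedField ℝ
  open CompleteOrderedFieldProperties ℝ
  open FiniteMetricSpace X
  open Model ℝ X s₀
  open Reasoning
  open MaxOp (Max.maxOperator ≤-totalOrder) using (x≤x⊔y; x≤y⊔x)

  triangle : ∀ p q r → d p r ≤ d p q + d q r
  triangle p q r = IsGeneralMetric.triangle isMetric p q r

  d≥0 : ∀ p q → 0# ≤ d p q
  d≥0 p q = IsGeneralMetric.nonNegative isMetric

  d-self : ∀ p → d p p ≈ 0#
  d-self p = IsGeneralMetric.≈⇒0 isMetric ≡.refl

  -- `List⁺.last` is computed through `initLast`, so the equation needs a case split before it holds
  -- by reduction.
  last-∷ : ∀ (v w : Point) ws → List⁺.last (v ∷ w ∷ ws) ≡ List⁺.last (w ∷ ws)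
  last-∷ v w ws with initLast ws
  ... | []      = ≡.refl
  ... | _ ∷ʳ′ _ = ≡.refl

  last≤len : ∀ v vs → d v (List⁺.last (v ∷ vs)) ≤ len (v ∷ vs)
  last≤len v []       = inj₂ (d-self v)
  last≤len v (w ∷ ws) rewrite last-∷ v w ws =
    ≤-trans (triangle v w _) (≤-refl +-≤ last≤len w ws)

  via≤len : ∀ {q} v vs → q ∈ v ∷ vs → d v q + d q (List⁺.last (v ∷ vs)) ≤ len (v ∷ vs)
  via≤len v vs (here ≡.refl) = begin
    d v v + d v (List⁺.last (v ∷ vs)) ≈⟨ +-congʳ (d-self v) ⟩
    0# + d v (List⁺.last (v ∷ vs))    ≈⟨ +-identityˡ _ ⟩
    d v (List⁺.last (v ∷ vs))         ≤⟨ last≤len v vs ⟩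
    len (v ∷ vs)                      ∎
  via≤len {q} v (w ∷ ws) (there q∈) rewrite last-∷ v w ws = begin
    d v q + d q z           ≤⟨ triangle v w q +-≤ ≤-refl ⟩
    d v w + d w q + d q z   ≈⟨ +-assoc _ _ _ ⟩
    d v w + (d w q + d q z) ≤⟨ ≤-refl +-≤ via≤len w ws q∈ ⟩
    d v w + len (w ∷ ws)    ∎
    where z = List⁺.last (w ∷ ws)

  delay≤maxDelay : ∀ {q} t p B → q ∈ p ∷ B → t - arrival q ≤ maxDelay t (p ∷ B)
  delay≤maxDelay t p []       (here ≡.refl) = ≤-refl
  delay≤maxDelay t p (r ∷ B)  (here ≡.refl) = x≤x⊔y _ _
  delay≤maxDelay t p (r ∷ B)  (there q∈)    =
    ≤-trans (delay≤maxDelay t r B q∈) (x≤y⊔x (t - arrival p) _)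

  -- The invariant behind nonnegative delays: `advance` renews it for the new time, and walks only
  -- remove pending requests.
  AllArrivedBy : Carrier → State → Set
  AllArrivedBy t st = ∀ q → pending st q → arrival q ≤ t

  advance-allArrivedBy : ∀ mode {ℓ t st} → ℓ ≤ t → AllArrivedBy ℓ st →
                         AllArrivedBy t (advance mode t st)
  advance-allArrivedBy mode ℓ≤t past q (inj₁ pending)       = ≤-trans (past q pending) ℓ≤t
  advance-allArrivedBy mode ℓ≤t past q (inj₂ (_ , q≤t , _)) = q≤t

  served⇒servable : ∀ mode {st e q} → LegalService mode st e → q ∈ served e →
                    Servable st (walk e) q
  served⇒servable elective  legal q∈ = legal _ q∈
  served⇒servable automatic legal q∈ = Equivalence.to (legal _) q∈

  serve≤stepCost : ∀ {q} t e → q ∈ served e → len (walk e) + (t - arrival q) ≤ stepCost t e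
  serve≤stepCost t (step P (p ∷ B)) q∈ = ≤-refl +-≤ delay≤maxDelay t p B q∈

  -- The charge for delay is at least the delay of the first served request, which was pending and
  -- so has arrived by `t`.
  len≤stepCost : ∀ mode {t st} e → LegalService mode st e → AllArrivedBy t st →
                 len (walk e) ≤ stepCost t e
  len≤stepCost mode     (step P [])      legal past = ≤-refl
  len≤stepCost mode {t} (step P (q ∷ B)) legal past = begin
    len P                   ≈⟨ +-identityʳ _ ⟨
    len P + 0#              ≤⟨ ≤-refl +-≤ x≤y⇒0≤y-x (past q (proj₁ (served⇒servable mode legal q∈))) ⟩
    len P + (t - arrival q) ≤⟨ serve≤stepCost t (step P (q ∷ B)) q∈ ⟩
    stepCost t (step P (q ∷ B)) ∎
    where
    q∈ : q ∈ q ∷ B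
    q∈ = here ≡.refl

  -- Positions are read off the actions alone, without states, so that an equality of schedules
  -- carries over to positions.
  stepsEnd : Point → List Step → Point
  stepsEnd p []       = p
  stepsEnd p (e ∷ es) = stepsEnd (List⁺.last (walk e)) es

  end : Point → Schedule → Point
  end p []       = p
  end p (a ∷ S)  = end (stepsEnd p (steps a)) S

  position-executes : ∀ st es → position (foldl execute st es) ≡ stepsEnd (position st) es
  position-executes st []       = ≡.refl
  position-executes st (e ∷ es) = position-executes (execute st e) es

  upcoming-executes : ∀ st es → upcoming (foldl execute st es) ≡ upcoming st
  upcoming-executes st []       = ≡.refl
  upcoming-executes st (e ∷ es) = upcoming-executes (execute st e) es

  executes-allArrivedBy : ∀ {t} st es → AllArrivedBy t st → AllArrivedBy t (foldl execute st es)
  executes-allArrivedBy st []       past = past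
  executes-allArrivedBy st (e ∷ es) past =
    executes-allArrivedBy (execute st e) es λ q (pending , _) → past q pending

  stepTravel : ∀ mode {t st} e → LegalStep mode st e → AllArrivedBy t st →
               d (position st) (List⁺.last (walk e)) ≤ stepCost t e
  stepTravel mode e@(step (v ∷ vs) _) (≡.refl , legal) past =
    ≤-trans (last≤len v vs) (len≤stepCost mode e legal past)

  stepsTravel : ∀ mode {t st} es → LegalSteps mode st es → AllArrivedBy t st →
                d (position st) (stepsEnd (position st) es) ≤ actionCost (action t es)
  stepsTravel mode {st = st} [] _ past = inj₂ (d-self (position st))
  stepsTravel mode {st = st} (e ∷ es) (legal , legals) past =
    ≤-trans (triangle (position st) (List⁺.last (walk e)) _)
      (stepTravel mode e legal past +-≤ stepsTravel mode es legals λ q (pending , _) → past q pending)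

  -- The walk that serves `r` passes through its location, so all movement of the action can be
  -- split there. The way onward from `r` is kept in the bound for later triangle inequalities.
  stepsServe : ∀ mode {t st r} es → LegalSteps mode st es → AllArrivedBy t st → pending st r →
               pending (foldl execute st es) r ⊎
               d (position st) (location r) + (t - arrival r)
                 + d (location r) (stepsEnd (position st) es) ≤ actionCost (action t es)
  stepsServe mode [] _ past pending = inj₁ pending
  stepsServe mode {t} {st} {r} (e@(step (v ∷ vs) B) ∷ es) ((≡.refl , legal) , legals) past pending
    -- Membership involves propositional equality of arrivals, whereas the field decides only `≈`.
    with excludedMiddle (r ∈ B)
  ... | yes r∈B = inj₂ (≤-from
    (serve≤stepCost t e r∈B
      +-≤ via≤len v vs (proj₂ (served⇒servable mode legal r∈B))
      +-≤ stepsTravel mode es legals past′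
      +-≤ triangle (location r) w z)
    (solve 8 (λ vr δ rz sc rw wz C L →
        vr :+ δ :+ rz :+ (sc :+ (L :+ (C :+ (rw :+ wz))))
        := sc :+ C :+ (L :+ δ :+ (vr :+ rw :+ (wz :+ rz))))
      refl (d v (location r)) (t - arrival r) (d (location r) z) (stepCost t e)
      (d (location r) w) (d w z) (actionCost (action t es)) (len (v ∷ vs))))
    where
    w = List⁺.last (v ∷ vs)
    z = stepsEnd w es
    past′ = λ q (pending , _) → past q pending
  ... | no  r∉B with stepsServe mode es legals (λ q (pending , _) → past q pending) (pending , r∉B)
  ...   | inj₁ pending′ = inj₁ pending′
  ...   | inj₂ served≤  = inj₂ (≤-from
    (stepTravel mode {st = st} e (≡.refl , legal) past +-≤ triangle v w (location r) +-≤ served≤)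
    (solve 7 (λ vr δ rz sc vw wr C →
        vr :+ δ :+ rz :+ (sc :+ (vw :+ wr :+ C)) := sc :+ C :+ (vw :+ (vr :+ (wr :+ δ :+ rz))))
      refl (d v (location r)) (t - arrival r) (d (location r) z) (stepCost t e)
      (d v w) (d w (location r)) (actionCost (action t es))))
    where
    w = List⁺.last (v ∷ vs)
    z = stepsEnd w es

  -- Merges sortedness and a lower bound on the timestamps into one condition that the tail of a
  -- schedule inherits.
  TimedFrom : Carrier → Schedule → Set
  TimedFrom ℓ []      = ⊤
  TimedFrom ℓ (a ∷ S) = ℓ ≤ time a × TimedFrom (time a) S

  timedFrom : ∀ {ℓ S} → All (λ a → ℓ ≤ time a) S → Linked (λ a b → time a ≤ time b) S → TimedFrom ℓ S
  timedFrom []        []            = tt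
  timedFrom (ℓ≤ ∷ _)  [-]           = ℓ≤ , tt
  timedFrom (ℓ≤ ∷ _)  (a≤b ∷ sorted) = ℓ≤ , timedFrom′ a≤b sorted
    where
    timedFrom′ : ∀ {ℓ a S} → ℓ ≤ time a → Linked (λ a b → time a ≤ time b) (a ∷ S) → TimedFrom ℓ (a ∷ S)
    timedFrom′ ℓ≤ [-]            = ℓ≤ , tt
    timedFrom′ ℓ≤ (a≤b ∷ sorted) = ℓ≤ , timedFrom′ a≤b sorted

  timedFrom⇒all : ∀ {ℓ ℓ′} S → ℓ ≤ ℓ′ → TimedFrom ℓ′ S → All (λ a → ℓ ≤ time a) S
  timedFrom⇒all []      ℓ≤ _            = []
  timedFrom⇒all (a ∷ S) ℓ≤ (ℓ′≤ , timed) = ≤-trans ℓ≤ ℓ′≤ ∷ timedFrom⇒all S (≤-trans ℓ≤ ℓ′≤) timed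

  timedFrom⇒linked : ∀ {ℓ} S → TimedFrom ℓ S → Linked (λ a b → time a ≤ time b) S
  timedFrom⇒linked []          _                 = []
  timedFrom⇒linked (a ∷ [])    _                 = [-]
  timedFrom⇒linked (a ∷ b ∷ S) (_ , a≤b , timed) = a≤b ∷ timedFrom⇒linked (b ∷ S) (a≤b , timed)

  actionsUpTo-accept : ∀ {τ a} S → time a ≤ τ → actionsUpTo τ (a ∷ S) ≡ a ∷ actionsUpTo τ S
  actionsUpTo-accept {τ} S t≤τ = filter-accept (λ b → time b ≤? τ) t≤τ

  -- This is what makes `actionsUpTo τ` a prefix of a sorted schedule and not merely a sublist.
  actionsUpTo-none : ∀ {τ ℓ} S → τ < ℓ → TimedFrom ℓ S → actionsUpTo τ S ≡ []
  actionsUpTo-none {τ} S τ<ℓ timed = filter-none (λ b → time b ≤? τ) (none S τ<ℓ timed)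
    where
    none : ∀ {ℓ} S → τ < ℓ → TimedFrom ℓ S → All (λ a → ¬ (time a ≤ τ)) S
    none []      _   _           = []
    none (a ∷ S) τ<ℓ (ℓ≤ , timed) =
      (λ a≤τ → ≤⇒≯ a≤τ (<-≤-trans τ<ℓ ℓ≤)) ∷ none S (<-≤-trans τ<ℓ ℓ≤) timed

  -- Extracts from legality the part that bounds on prefixes of a schedule use, in a form that
  -- mentions no states.
  PaysForTravel : Point → Schedule → Set
  PaysForTravel p []      = ⊤
  PaysForTravel p (a ∷ S) =
    d p (stepsEnd p (steps a)) ≤ actionCost a × PaysForTravel (stepsEnd p (steps a)) S

  paysForTravel : ∀ mode {ℓ p st} S → position st ≡ p → LegalFrom mode st S → TimedFrom ℓ S →
                  AllArrivedBy ℓ st → PaysForTravel p S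
  paysForTravel mode [] _ _ _ _ = tt
  paysForTravel mode {st = st} (action t es ∷ S) ≡.refl (legals , legal) (ℓ≤t , timed) past =
    stepsTravel mode es legals past′ ,
    paysForTravel mode S (position-executes (advance mode t st) es) legal timed
      (executes-allArrivedBy _ es past′)
    where past′ = advance-allArrivedBy mode ℓ≤t past

  0≤cost : ∀ {p} S → PaysForTravel p S → 0# ≤ cost S
  0≤cost []      _             = ≤-refl
  0≤cost (a ∷ S) (travel , pays) = begin
    0#                    ≈⟨ +-identityʳ 0# ⟨
    0# + 0#               ≤⟨ ≤-trans (d≥0 _ _) travel +-≤ 0≤cost S pays ⟩
    actionCost a + cost S ∎

  cost-actionsUpTo≤ : ∀ {p} τ S → PaysForTravel p S → cost (actionsUpTo τ S) ≤ cost S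
  cost-actionsUpTo≤ τ []      _ = ≤-refl
  cost-actionsUpTo≤ τ (a ∷ S) (travel , pays) with time a ≤? τ
  ... | yes _ = ≤-refl +-≤ cost-actionsUpTo≤ τ S pays
  ... | no  _ = begin
    cost (actionsUpTo τ S)      ≈⟨ +-identityˡ _ ⟨
    0# + cost (actionsUpTo τ S) ≤⟨ ≤-trans (d≥0 _ _) travel +-≤ cost-actionsUpTo≤ τ S pays ⟩
    actionCost a + cost S       ∎

  travel≤cost : ∀ {p ℓ} τ S → PaysForTravel p S → TimedFrom ℓ S →
                d p (end p (actionsUpTo τ S)) ≤ cost (actionsUpTo τ S)
  travel≤cost {p} τ [] _ _ = inj₂ (d-self p)
  travel≤cost {p} τ (a ∷ S) (travel , pays) (_ , timed) with time a ≤? τ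
  ... | yes _   = ≤-trans (triangle p _ _) (travel +-≤ travel≤cost τ S pays timed)
  ... | no  a≰τ rewrite actionsUpTo-none S (≰⇒> a≰τ) timed = inj₂ (d-self p)

  -- A server starting at p visits the location of r in order to serve r at
  -- time τ, and travels on to its position at the end of time τ; the delay
  -- τ - arrival r is charged on top.
  ServedAt : Request → Point → Schedule → Carrier → Set
  ServedAt r p S τ =
    d p (location r) + τ + d (location r) (end p (actionsUpTo τ S))
      ≤ cost (actionsUpTo τ S) + arrival r

  -- An earlier action may change the starting point only by a distance that it pays for.
  servedAt-∷ : ∀ {r p τ} a S → d p (stepsEnd p (steps a)) ≤ actionCost a → time a ≤ τ →
               ServedAt r (stepsEnd p (steps a)) S τ → ServedAt r p (a ∷ S) τ
  servedAt-∷ {r} {p} {τ} a S travel a≤τ served≤ rewrite actionsUpTo-accept {a = a} S a≤τ = ≤-from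
    (travel +-≤ triangle p p′ (location r) +-≤ served≤)
    (solve 8 (λ pr τ re A C arr pp p′r →
        pr :+ τ :+ re :+ (A :+ (pp :+ p′r :+ (C :+ arr)))
        := A :+ C :+ arr :+ (pp :+ (pr :+ (p′r :+ τ :+ re))))
      refl (d p (location r)) τ (d (location r) (end p′ (actionsUpTo τ S))) (actionCost a)
      (cost (actionsUpTo τ S)) (arrival r) (d p p′) (d p′ (location r)))
    where p′ = stepsEnd p (steps a)

  -- The cost of serving one given request.

  mutual
    -- The empty schedule is illegal while `r` is pending, so the recursion meets an action that
    -- serves `r`; its timestamp becomes `τ`.
    servePending : ∀ mode {ℓ r p st} S → position st ≡ p → LegalFrom mode st S → TimedFrom ℓ S →
                   AllArrivedBy ℓ st → pending st r → ∃[ τ ] ℓ ≤ τ × ServedAt r p S τ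
    servePending mode [] _ legal _ _ r-pending = contradiction (inj₁ r-pending) (legal _)
    servePending mode (a ∷ S) at legal (ℓ≤t , timed) past r-pending
      with τ , t≤τ , served≤ ← serveNow mode a S at legal (ℓ≤t , timed) past (inj₁ r-pending)
      = τ , ≤-trans ℓ≤t t≤τ , served≤

    serveNow : ∀ mode {ℓ r p st} a S → position st ≡ p → LegalFrom mode st (a ∷ S) →
               TimedFrom ℓ (a ∷ S) → AllArrivedBy ℓ st → pending (advance mode (time a) st) r →
               ∃[ τ ] time a ≤ τ × ServedAt r p (a ∷ S) τ
    serveNow mode {r = r} {p} {st} a@(action t es) S ≡.refl (legals , legal) (ℓ≤t , timed) past r-pending
      with past′ ← advance-allArrivedBy mode {st = st} ℓ≤t past
      with stepsServe mode es legals past′ r-pending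
    ... | inj₁ r-pending′
      with τ , t≤τ , served≤ ← servePending mode S (position-executes (advance mode t st) es) legal timed
                                 (executes-allArrivedBy _ es past′) r-pending′
      = τ , t≤τ , servedAt-∷ {r} a S (stepsTravel mode es legals past′) t≤τ served≤
    -- Further actions at the same time `t` may follow the service; they count towards
    -- `actionsUpTo t` and pay for their own travel.
    ... | inj₂ served≤ = t , ≤-refl , ≡.subst
      (λ F → d p (location r) + t + d (location r) (end p F) ≤ cost F + arrival r)
      (≡.sym (actionsUpTo-accept S ≤-refl))
      (≤-from
        (served≤
          +-≤ travel≤cost t S pays timed
          +-≤ triangle (location r) p′ e
          +-≤ inj₂ (sym (x+[y-x]≈y (arrival r) t)))
        (solve 9 (λ pr t re A C arr p′e δ rp →
            pr :+ t :+ re :+ (A :+ (C :+ (rp :+ p′e :+ (arr :+ δ))))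
            := A :+ C :+ arr :+ (pr :+ δ :+ rp :+ (p′e :+ (re :+ t))))
          refl (d p (location r)) t (d (location r) e) (actionCost a) (cost (actionsUpTo t S))
          (arrival r) (d p′ e) (t - arrival r) (d (location r) p′)))
      where
      p′ = stepsEnd p es
      e  = end p′ (actionsUpTo t S)
      pays : PaysForTravel p′ S
      pays = paysForTravel mode S (position-executes (advance mode t st) es) legal timed
               (executes-allArrivedBy _ es past′)

  becomesPending? : ∀ mode p r → BecomesPending mode p r ⊎ p ≡ location r
  becomesPending? elective  p r = inj₁ tt
  becomesPending? automatic p r with p Fin.≟ location r
  ... | yes p≡r = inj₂ p≡r
  ... | no  p≢r = inj₁ λ r≡p → p≢r (≡.sym r≡p)

  -- With the server already at `r` and no delay, only the travel made up to `arrival r` remains to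
  -- be paid.
  servedOnArrival : ∀ {r p ℓ} S → p ≡ location r → PaysForTravel p S → TimedFrom ℓ S →
                    ServedAt r p S (arrival r)
  servedOnArrival {r} {p} S ≡.refl pays timed = ≤-from
    (travel≤cost (arrival r) S pays timed +-≤ inj₂ (d-self p))
    (solve 4 (λ pp arr pe C → pp :+ arr :+ pe :+ (C :+ con 0) := C :+ arr :+ (pe :+ pp))
      refl (d p p) (arrival r) (d p (end p (actionsUpTo (arrival r) S)))
      (cost (actionsUpTo (arrival r) S)))

  -- Actions before the arrival of `r` are skipped as mere travel. Once its epoch is processed, `r`
  -- is either pending or was served where the server stood.
  serveUpcoming : ∀ mode {ℓ r p st} S → position st ≡ p → LegalFrom mode st S → TimedFrom ℓ S →
                  AllArrivedBy ℓ st → upcoming st r → ∃[ τ ] arrival r ≤ τ × ServedAt r p S τ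
  serveUpcoming mode {r = r} {p} [] ≡.refl legal timed past up with becomesPending? mode p r
  ... | inj₁ becomes = contradiction (inj₂ (up , becomes)) (legal r)
  ... | inj₂ p≡r     = arrival r , ≤-refl , servedOnArrival {r} {ℓ = arrival r} [] p≡r tt tt
  serveUpcoming mode {ℓ} {r} {p} {st} S@(a@(action t es) ∷ S′) ≡.refl legal@(legals , legal′)
                timed@(ℓ≤t , timed′) past up
    with arrival r ≤? t | becomesPending? mode p r
  ... | yes r≤t | inj₁ becomes
    with τ , t≤τ , served≤ ← serveNow mode a S′ ≡.refl legal timed past (inj₂ (up , r≤t , becomes))
    = τ , ≤-trans r≤t t≤τ , served≤
  ... | yes r≤t | inj₂ p≡r =
    arrival r , ≤-refl , servedOnArrival {r} S p≡r (paysForTravel mode {ℓ} S ≡.refl legal timed past) timed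
  ... | no  r≰t | _
    with past′ ← advance-allArrivedBy mode {st = st} ℓ≤t past
    with τ , r≤τ , served≤ ← serveUpcoming mode S′ (position-executes (advance mode t st) es) legal′ timed′
                               (executes-allArrivedBy _ es past′)
                               (≡.subst (λ U → U r) (≡.sym (upcoming-executes (advance mode t st) es)) (up , ≰⇒> r≰t))
    = τ , r≤τ ,
      servedAt-∷ {r} a S′ (stepsTravel mode es legals past′) (≤-trans (inj₁ (≰⇒> r≰t)) r≤τ) served≤

  -- Separates the actions up to `τ₀`, which an online algorithm fixes before it sees `r`, from the
  -- additional cost that `r` causes.
  serveAfter : ∀ mode {ℓ r p st τ₀} S → position st ≡ p → LegalFrom mode st S → TimedFrom ℓ S →
               AllArrivedBy ℓ st → upcoming st r → τ₀ < arrival r →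
               ∃[ τ ] arrival r ≤ τ ×
                 cost (actionsUpTo τ₀ S) + (d (end p (actionsUpTo τ₀ S)) (location r) + τ
                   + d (location r) (end p (actionsUpTo τ S)))
                 ≤ cost (actionsUpTo τ S) + arrival r
  serveAfter mode [] at legal timed past up τ₀<r
    with τ , r≤τ , served≤ ← serveUpcoming mode [] at legal timed past up
    = τ , r≤τ , ≤-trans (inj₂ (+-identityˡ _)) served≤
  serveAfter mode {ℓ} {r} {p} {st} {τ₀} S@(a@(action t es) ∷ S′) at legal@(legals , legal′)
             timed@(ℓ≤t , timed′) past up τ₀<r
    with t ≤? τ₀
  -- The prefix up to `τ₀` is exhausted here, so all remaining actions count as additional cost.
  ... | no  t≰τ₀ rewrite actionsUpTo-none S′ (≰⇒> t≰τ₀) timed′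
    with τ , r≤τ , served≤ ← serveUpcoming mode S at legal timed past up
    = τ , r≤τ , ≤-trans (inj₂ (+-identityˡ _)) served≤
  serveAfter mode {ℓ} {r} {p} {st} {τ₀} S@(a@(action t es) ∷ S′) ≡.refl legal@(legals , legal′)
             timed@(ℓ≤t , timed′) past up τ₀<r
      | yes t≤τ₀
    with past′ ← advance-allArrivedBy mode {st = st} ℓ≤t past
    with τ , r≤τ , served≤ ← serveAfter mode S′ (position-executes (advance mode t st) es) legal′ timed′
                               (executes-allArrivedBy _ es past′)
                               (≡.subst (λ U → U r) (≡.sym (upcoming-executes (advance mode t st) es))
                                 (up , ≤-<-trans t≤τ₀ τ₀<r))
                               τ₀<r
    = τ , r≤τ , bound
    where
    bound : actionCost a + cost (actionsUpTo τ₀ S′)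
              + (d (end p (a ∷ actionsUpTo τ₀ S′)) (location r) + τ + d (location r) (end p (actionsUpTo τ S)))
            ≤ cost (actionsUpTo τ S) + arrival r
    bound rewrite actionsUpTo-accept {a = a} S′ (≤-trans t≤τ₀ (≤-trans (inj₁ τ₀<r) r≤τ)) = begin
      A + C₀ + Y        ≈⟨ +-assoc A C₀ Y ⟩
      A + (C₀ + Y)      ≤⟨ ≤-refl +-≤ served≤ ⟩
      A + (C + arrival r) ≈⟨ +-assoc A C (arrival r) ⟨
      A + C + arrival r ∎
      where
      p′ = stepsEnd p es
      A  = actionCost a
      C₀ = cost (actionsUpTo τ₀ S′)
      C  = cost (actionsUpTo τ S′)
      Y  = d (end p′ (actionsUpTo τ₀ S′)) (location r) + τ + d (location r) (end p′ (actionsUpTo τ S′))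

-- Clairvoyant schedules for alternating requests on the two-point line.

module TwoPointLine (ℝ : CompleteOrderedField) (D : CompleteOrderedField.Carrier ℝ)
                    (0<D : CompleteOrderedField._<_ ℝ (CompleteOrderedField.0# ℝ) D) where
  open CompleteOrderedField ℝ
  open CompleteOrderedFieldProperties ℝ
  open FiniteMetricSpace (twoPointLine ℝ D 0<D)
  open Model ℝ (twoPointLine ℝ D 0<D) zero
  open ModelProperties ℝ (twoPointLine ℝ D 0<D) zero
  open Reasoning
  open Equivalence using (to; from)

  other : Point → Point
  other zero       = suc zero
  other (suc zero) = zero

  other-involutive : ∀ p → other (other p) ≡ p
  other-involutive zero       = ≡.refl
  other-involutive (suc zero) = ≡.refl

  other≢ : ∀ p → other p ≢ p
  other≢ zero       ()
  other≢ (suc zero) ()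

  d-other : ∀ p → d p (other p) ≡ D
  d-other zero       = ≡.refl
  d-other (suc zero) = ≡.refl

  -- The first index is the point before the first request; the second is the location of the last
  -- request, or the first index again if there is none.
  data Zigzag : Point → List Request → Point → Set where
    []  : ∀ {p} → Zigzag p [] p
    _∷_ : ∀ {p r rs z} → location r ≡ other p → Zigzag (other p) rs z → Zigzag p (r ∷ rs) z

  zigzag-∷ʳ : ∀ {p rs z r} → Zigzag p rs z → location r ≡ other z → Zigzag p (rs ∷ʳ r) (other z)
  zigzag-∷ʳ []       at = at ∷ []
  zigzag-∷ʳ (l ∷ zz) at = l ∷ zigzag-∷ʳ zz at

  -- Strictness makes every arrival epoch a single request.
  Increasing : List Request → Set
  Increasing = AllPairs (λ q r → arrival q < arrival r)

  -- `advance` and `execute` pile conditions onto predicates, so states are compared with lists only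
  -- up to equivalence of membership.
  record Describes (p : Point) (ps us : List Request) (st : State) : Set where
    field
      at-position : position st ≡ p
      pending⇔    : ∀ q → pending st q ⇔ q ∈ ps
      upcoming⇔   : ∀ q → upcoming st q ⇔ q ∈ us
  open Describes

  -- Effect of single arrivals and services on a described state.

  advance-none : ∀ mode {p ps us st t} → Describes p ps us st → All (λ q → t < arrival q) us →
                 Describes p ps us (advance mode t st)
  advance-none mode {t = t} desc later = record
    { at-position = at-position desc
    ; pending⇔    = λ q → mk⇔
        (λ { (inj₁ q-pending)      → to (pending⇔ desc q) q-pending
           ; (inj₂ (up , q≤t , _)) →
               contradiction (All.lookup later (to (upcoming⇔ desc q) up)) (≤⇒≯ q≤t) })
        (λ q∈ps → inj₁ (from (pending⇔ desc q) q∈ps))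
    ; upcoming⇔   = λ q → mk⇔
        (λ (up , _) → to (upcoming⇔ desc q) up)
        (λ q∈us → from (upcoming⇔ desc q) q∈us , All.lookup later q∈us)
    }

  upcoming-next : ∀ {us r} (U : Request → Set) → (∀ q → U q ⇔ q ∈ r ∷ us) →
                  All (λ q → arrival r < arrival q) us →
                  ∀ q → (U q × arrival r < arrival q) ⇔ q ∈ us
  upcoming-next {us} {r} U U⇔ later q = mk⇔ (λ (up , r<q) → drop-head (to (U⇔ q) up) r<q)
    (λ q∈us → from (U⇔ q) (there q∈us) , All.lookup later q∈us)
    where
    drop-head : q ∈ r ∷ us → arrival r < arrival q → q ∈ us
    drop-head (here ≡.refl) r<r = contradiction r<r (≤⇒≯ ≤-refl)
    drop-head (there q∈us)  _   = q∈us

  advance-pending : ∀ mode {p ps us r st} → Describes p ps (r ∷ us) st →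
                    All (λ q → arrival r < arrival q) us → BecomesPending mode p r →
                    Describes p (r ∷ ps) us (advance mode (arrival r) st)
  advance-pending mode {p} {ps} {us} {r} {st} desc later becomes = record
    { at-position = at-position desc
    ; pending⇔    = λ q → mk⇔ forth back
    ; upcoming⇔   = upcoming-next (upcoming st) (upcoming⇔ desc) later
    }
    where
    forth : ∀ {q} → pending (advance mode (arrival r) st) q → q ∈ r ∷ ps
    forth {q} (inj₁ q-pending) = there (to (pending⇔ desc q) q-pending)
    forth {q} (inj₂ (up , q≤r , _)) with to (upcoming⇔ desc q) up
    ... | here ≡.refl = here ≡.refl
    ... | there q∈us  = contradiction (All.lookup later q∈us) (≤⇒≯ q≤r)
    back : ∀ {q} → q ∈ r ∷ ps → pending (advance mode (arrival r) st) q
    back (here ≡.refl) = inj₂ (from (upcoming⇔ desc r) (here ≡.refl) , ≤-refl ,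
      ≡.subst (λ p → BecomesPending mode p r) (≡.sym (at-position desc)) becomes)
    back {q} (there q∈ps) = inj₁ (from (pending⇔ desc q) q∈ps)

  advance-automatic : ∀ {p ps us r st} → Describes p ps (r ∷ us) st →
                      All (λ q → arrival r < arrival q) us → location r ≡ p →
                      Describes p ps us (advance automatic (arrival r) st)
  advance-automatic {p} {ps} {us} {r} {st} desc later r-at-p = record
    { at-position = at-position desc
    ; pending⇔    = λ q → mk⇔ forth (λ q∈ps → inj₁ (from (pending⇔ desc q) q∈ps))
    ; upcoming⇔   = upcoming-next (upcoming st) (upcoming⇔ desc) later
    }
    where
    forth : ∀ {q} → pending (advance automatic (arrival r) st) q → q ∈ ps
    forth {q} (inj₁ q-pending) = to (pending⇔ desc q) q-pending
    forth {q} (inj₂ (up , q≤r , q-elsewhere)) with to (upcoming⇔ desc q) up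
    ... | here ≡.refl = contradiction (≡.trans r-at-p (≡.sym (at-position desc))) q-elsewhere
    ... | there q∈us  = contradiction (All.lookup later q∈us) (≤⇒≯ q≤r)

  execute-serve : ∀ {p ps us r st} w → Describes p (r ∷ ps) us st → r ∉ ps →
                  Describes (List⁺.last w) ps us (execute st (step w (r ∷ [])))
  execute-serve {p} {ps} {us} {r} {st} w desc r∉ps = record
    { at-position = ≡.refl
    ; pending⇔    = λ q → mk⇔ forth back
    ; upcoming⇔   = upcoming⇔ desc
    }
    where
    forth : ∀ {q} → pending st q × q ∉ r ∷ [] → q ∈ ps
    forth {q} (q-pending , q∉) with to (pending⇔ desc q) q-pending
    ... | here ≡.refl = contradiction (here ≡.refl) q∉
    ... | there q∈ps  = q∈ps
    back : ∀ {q} → q ∈ ps → pending st q × q ∉ r ∷ []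
    back {q} q∈ps = from (pending⇔ desc q) (there q∈ps) , λ { (here ≡.refl) → r∉ps q∈ps }

  -- The combinators below prepend one action to a plan that is given for every state with the
  -- resulting description.
  record Plan (mode : Service) (st : State) (ℓ c : Carrier) : Set where
    field
      schedule : Schedule
      legal    : LegalFrom mode st schedule
      timed    : TimedFrom ℓ schedule
      cost≤    : cost schedule ≤ c
  open Plan

  plan-≤ : ∀ {mode st ℓ c c′} → c ≤ c′ → Plan mode st ℓ c → Plan mode st ℓ c′
  plan-≤ c≤c′ plan = record
    { schedule = schedule plan ; legal = legal plan ; timed = timed plan
    ; cost≤ = ≤-trans (cost≤ plan) c≤c′ }

  plan-done : ∀ {mode p st ℓ} → Describes p [] [] st → Plan mode st ℓ 0#
  plan-done desc = record
    { schedule = []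
    ; legal    = λ { q (inj₁ q-pending) → contradiction (to (pending⇔ desc q) q-pending) λ ()
                   ; q (inj₂ (up , _))  → contradiction (to (upcoming⇔ desc q) up) λ () }
    ; timed    = tt
    ; cost≤    = ≤-refl
    }

  -- An action without walks only lets the epoch be processed. A request away from the server
  -- becomes pending in both modes.
  plan-wait : ∀ {mode p r us st ℓ c} → Describes p [] (r ∷ us) st → location r ≡ other p →
              All (λ q → arrival r < arrival q) us → ℓ ≤ arrival r →
              (∀ {st′} → Describes p (r ∷ []) us st′ → Plan mode st′ (arrival r) c) →
              Plan mode st ℓ c
  plan-wait {mode} {p} {r} desc r-at later ℓ≤r continue = record
    { schedule = action (arrival r) [] ∷ schedule rest
    ; legal    = tt , legal rest
    ; timed    = ℓ≤r , timed rest
    ; cost≤    = ≤-trans (inj₂ (+-identityˡ _)) (cost≤ rest)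
    }
    where
    becomes : ∀ mode → BecomesPending mode p r
    becomes elective  = tt
    becomes automatic = λ r-at-p → other≢ p (≡.trans (≡.sym r-at) r-at-p)
    rest = continue (advance-pending mode desc later (becomes mode))

  -- Under automatic service the arrival rule serves `r`; under elective service a one-vertex walk
  -- does, with zero length and delay. Since `ps` lies at the other point, `r` is not in it and
  -- serving `r` leaves `ps` intact.
  plan-stay : ∀ {mode p ps r us st ℓ c} → Describes p ps (r ∷ us) st → location r ≡ p →
              All (λ q → location q ≡ other p) ps →
              All (λ q → arrival r < arrival q) us → ℓ ≤ arrival r →
              (∀ {st′} → Describes p ps us st′ → Plan mode st′ (arrival r) c) →
              Plan mode st ℓ c
  plan-stay {automatic} {r = r} desc r-at elsewhere later ℓ≤r continue = record
    { schedule = action (arrival r) [] ∷ schedule rest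
    ; legal    = tt , legal rest
    ; timed    = ℓ≤r , timed rest
    ; cost≤    = ≤-trans (inj₂ (+-identityˡ _)) (cost≤ rest)
    }
    where rest = continue (advance-automatic desc later r-at)
  plan-stay {elective} {p} {ps} {r} {us} {st} {c = c} desc r-at elsewhere later ℓ≤r continue = record
    { schedule = action (arrival r) (step (p ∷ []) (r ∷ []) ∷ []) ∷ schedule rest
    ; legal    = ((≡.sym (at-position desc) , serves) , tt) , legal rest
    ; timed    = ℓ≤r , timed rest
    ; cost≤    = begin
        0# + (arrival r - arrival r) + 0# + cost (schedule rest)
          ≈⟨ +-congʳ (+-congʳ (+-congˡ (-‿inverseʳ (arrival r)))) ⟩
        0# + 0# + 0# + cost (schedule rest)
          ≈⟨ solve 1 (λ C → con 0 :+ con 0 :+ con 0 :+ C := C) refl (cost (schedule rest)) ⟩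
        cost (schedule rest) ≤⟨ cost≤ rest ⟩
        c ∎
    }
    where
    desc′ : Describes p (r ∷ ps) us (advance elective (arrival r) st)
    desc′ = advance-pending elective desc later tt
    serves : ∀ q → q ∈ r ∷ [] → Servable (advance elective (arrival r) st) (p ∷ []) q
    serves q (here ≡.refl) = from (pending⇔ desc′ q) (here ≡.refl) , here r-at
    rest = continue (execute-serve (p ∷ []) desc′
      λ r∈ps → other≢ p (≡.trans (≡.sym (All.lookup elsewhere r∈ps)) r-at))

  plan-move : ∀ {mode p r us st ℓ t c} → Describes p (r ∷ []) us st → location r ≡ other p →
              All (λ q → t < arrival q) us → ℓ ≤ t →
              (∀ {st′} → Describes (other p) [] us st′ → Plan mode st′ t c) →
              Plan mode st ℓ (D + (t - arrival r) + c)
  plan-move {mode} {p} {r} {us} {st} {t = t} {c} desc r-at later ℓ≤t continue = record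
    { schedule = action t (step (p ∷ other p ∷ []) (r ∷ []) ∷ []) ∷ schedule rest
    ; legal    = ((≡.sym (at-position desc) , serves mode) , tt) , legal rest
    ; timed    = ℓ≤t , timed rest
    ; cost≤    = begin
        d p (other p) + 0# + (t - arrival r) + 0# + cost (schedule rest)
          ≈⟨ solve 3 (λ x δ C → x :+ con 0 :+ δ :+ con 0 :+ C := x :+ δ :+ C) refl
               (d p (other p)) (t - arrival r) (cost (schedule rest)) ⟩
        d p (other p) + (t - arrival r) + cost (schedule rest)
          ≡⟨ ≡.cong (λ x → x + (t - arrival r) + cost (schedule rest)) (d-other p) ⟩
        D + (t - arrival r) + cost (schedule rest)
          ≤⟨ ≤-refl +-≤ cost≤ rest ⟩
        D + (t - arrival r) + c ∎
    }
    where
    desc′ : ∀ {mode} → Describes p (r ∷ []) us (advance mode t st)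
    desc′ {mode} = advance-none mode desc later
    servable : ∀ {mode} q → q ∈ r ∷ [] → Servable (advance mode t st) (p ∷ other p ∷ []) q
    servable {mode} q (here ≡.refl) = from (pending⇔ (desc′ {mode}) q) (here ≡.refl) , there (here r-at)
    serves : ∀ mode → LegalService mode (advance mode t st) (step (p ∷ other p ∷ []) (r ∷ []))
    serves elective  q = servable {elective} q
    -- Automatic service demands that everything pending on the walk be served; `r` is all that is
    -- pending.
    serves automatic q = mk⇔ (servable {automatic} q)
      (λ (q-pending , _) → to (pending⇔ (desc′ {automatic}) q) q-pending)
    rest = continue (execute-serve (p ∷ other p ∷ []) (desc′ {mode}) λ ())

  -- Of three consecutive requests only the first costs anything: it waits
  -- until the second has been served for free, and the move towards it
  -- brings the server to the location of the third.
  lazyCost : List Request → Carrier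
  lazyCost []                = 0#
  lazyCost (q ∷ [])          = D
  lazyCost (q ∷ r ∷ [])      = D + (arrival r - arrival q) + 0#
  lazyCost (q ∷ r ∷ _ ∷ us)  = D + (arrival r - arrival q) + lazyCost us

  lazyPlan : ∀ {mode p us z st ℓ} → Describes p [] us st → Zigzag p us z → Increasing us →
             All (λ q → ℓ ≤ arrival q) us → Plan mode st ℓ (lazyCost us)
  lazyPlan desc [] _ _ = plan-done desc
  lazyPlan {us = q ∷ []} desc (q-at ∷ []) _ (ℓ≤q ∷ _) =
    plan-wait desc q-at [] ℓ≤q λ desc →
    plan-≤ (inj₂ (trans (+-identityʳ _) (trans (+-congˡ (-‿inverseʳ (arrival q))) (+-identityʳ D))))
      (plan-move desc q-at [] ≤-refl plan-done)
  lazyPlan {p = p} {us = q ∷ r ∷ []} desc (q-at ∷ r-at ∷ []) ((q<r ∷ _) ∷ _) (ℓ≤q ∷ _) =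
    plan-wait desc q-at (q<r ∷ []) ℓ≤q λ desc →
    plan-stay desc (≡.trans r-at (other-involutive p)) (q-at ∷ []) [] (inj₁ q<r) λ desc →
    plan-move desc q-at [] ≤-refl plan-done
  lazyPlan {p = p} {us = q ∷ r ∷ s ∷ us} {z} desc (q-at ∷ r-at ∷ s-at ∷ zz)
           (q<@(q<r ∷ _) ∷ r<@(r<s ∷ _) ∷ s< ∷ inc) (ℓ≤q ∷ _) =
    plan-wait desc q-at q< ℓ≤q λ desc →
    plan-stay desc (≡.trans r-at (other-involutive p)) (q-at ∷ []) r< (inj₁ q<r) λ desc →
    -- Here `≤-refl` sets the move at `arrival r`, right after `r` has been served and before `s`
    -- arrives.
    plan-move desc q-at r< ≤-refl λ desc →
    plan-stay desc (≡.trans s-at (≡.cong other (other-involutive p))) [] s< (inj₁ r<s) λ desc →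
    -- Three switches of side amount to one, so the server is at the location of `s`, where the rest
    -- of the zigzag starts.
    lazyPlan desc (≡.subst (λ p → Zigzag p us z) (≡.cong other (other-involutive p)) zz)
      inc (All.map inj₁ s<)

  0≤n·D : ∀ n → 0# ≤ n · D
  0≤n·D ℕ.zero    = ≤-refl
  0≤n·D (ℕ.suc n) = ≤-trans (inj₂ (sym (+-identityʳ 0#))) (inj₁ 0<D +-≤ 0≤n·D n)

  greedyThenLazyPlan : ∀ {mode p us z st ℓ} k → Describes p [] us st → Zigzag p us z → Increasing us →
                       All (λ q → ℓ ≤ arrival q) us →
                       Plan mode st ℓ (k · D + lazyCost (drop k us))
  greedyThenLazyPlan ℕ.zero desc zz inc ℓ≤ =
    plan-≤ (inj₂ (sym (+-identityˡ _))) (lazyPlan desc zz inc ℓ≤)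
  greedyThenLazyPlan (ℕ.suc k) desc [] _ _ =
    plan-≤ (≤-trans (0≤n·D (ℕ.suc k)) (inj₂ (sym (+-identityʳ _)))) (plan-done desc)
  greedyThenLazyPlan {us = q ∷ us} (ℕ.suc k) desc (q-at ∷ zz) (q< ∷ inc) (ℓ≤q ∷ _) =
    plan-wait desc q-at q< ℓ≤q λ desc →
    plan-≤ (inj₂ (trans (+-congʳ (trans (+-congˡ (-‿inverseʳ (arrival q))) (+-identityʳ D)))
                        (sym (+-assoc D _ _))))
      (plan-move desc q-at q< ≤-refl λ desc → greedyThenLazyPlan k desc zz inc (All.map inj₁ q<))

  -- Covers the lists of length two and of length at least three by one recurrence.
  lazyCost-∷ : ∀ q r us → lazyCost (q ∷ r ∷ us) ≡ D + (arrival r - arrival q) + lazyCost (drop 1 us)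
  lazyCost-∷ q r []       = ≡.refl
  lazyCost-∷ q r (_ ∷ us) = ≡.refl

  -- Prepending `q` to a list that starts with `r` replaces the last of the three costs by `D` plus
  -- the gap from `q` to `r` plus that cost. Hence each request adds `D`, and the gaps telescope.
  lazyCosts : ∀ {T ℓ} us → Increasing us → All (λ q → ℓ ≤ arrival q) us → All (λ q → arrival q ≤ T) us →
              ℓ ≤ T →
              lazyCost us + (lazyCost (drop 1 us) + lazyCost (drop 2 us)) + ℓ ≤ length us · D + T
  lazyCosts {T} {ℓ} [] _ _ _ ℓ≤T =
    ≤-from ℓ≤T (solve 2 (λ ℓ T → con 0 :+ (con 0 :+ con 0) :+ ℓ :+ T := con 0 :+ T :+ ℓ) refl ℓ T)
  lazyCosts {T} {ℓ} (q ∷ []) _ _ _ ℓ≤T =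
    ≤-from ℓ≤T (solve 3 (λ D ℓ T → D :+ (con 0 :+ con 0) :+ ℓ :+ T := D :+ con 0 :+ T :+ ℓ) refl D ℓ T)
  lazyCosts {T} {ℓ} (q ∷ us@(r ∷ vs)) (_ ∷ inc@(r< ∷ _)) (ℓ≤q ∷ _) (_ ∷ ≤T@(r≤T ∷ _)) _ = ≤-from
    (inj₂ (reflexive (lazyCost-∷ q r vs))
      -- The recursion starts its telescoping sum at `arrival r`.
      +-≤ lazyCosts us inc (≤-refl ∷ All.map inj₁ r<) ≤T r≤T
      +-≤ ℓ≤q +-≤ inj₂ (x+[y-x]≈y (arrival q) (arrival r)))
    (solve 11 (λ w D δ a b c ℓ q r T m →
        w :+ (b :+ c) :+ ℓ :+ (D :+ δ :+ a :+ (m :+ T :+ (q :+ r)))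
        := D :+ m :+ T :+ (w :+ (b :+ (c :+ a) :+ r :+ (ℓ :+ (q :+ δ)))))
      refl (lazyCost (q ∷ us)) D (arrival r - arrival q) (lazyCost (drop 1 vs)) (lazyCost us)
      (lazyCost vs) ℓ (arrival q) (arrival r) T (length us · D))

  -- From plans to an upper bound on the optimum.

  plan⇒feasible : ∀ {mode I c} (plan : Plan mode (initial I) 0# c) → Feasible mode I (schedule plan)
  plan⇒feasible plan = record
    { times-≥0     = timedFrom⇒all (schedule plan) ≤-refl (timed plan)
    ; times-sorted = timedFrom⇒linked (schedule plan) (timed plan)
    ; legal        = legal plan
    }

  initial-describes : ∀ I → Describes zero [] (requests I) (initial I)
  initial-describes I = record
    { at-position = ≡.refl
    ; pending⇔    = λ q → mk⇔ (λ ()) (λ ())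
    ; upcoming⇔   = λ q → mk⇔ (λ up → up) (λ up → up)
    }

  3opt≤ : ∀ {mode I opt z T} → IsOPT mode I opt → Zigzag zero (requests I) z → Increasing (requests I) →
          All (λ q → arrival q ≤ T) (requests I) → 0# ≤ T →
          opt + (opt + opt) ≤ 3 · D + (length (requests I) · D + T)
  3opt≤ {mode} {I} {opt} {T = T} (lower , _) zz inc ≤T 0≤T = ≤-from
    -- The greedy prefixes contribute `0`, `D` and `D + D`, which explains `3 · D`.
    (opt≤ 0 +-≤ opt≤ 1 +-≤ opt≤ 2 +-≤ lazyCosts us inc (arrivals-≥0 I) ≤T 0≤T)
    (solve 7 (λ o D a b c m T →
        o :+ (o :+ o) :+ (con 0 :+ a :+ (D :+ con 0 :+ b :+ (D :+ (D :+ con 0) :+ c :+ (m :+ T))))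
        := D :+ (D :+ (D :+ con 0)) :+ (m :+ T) :+ (o :+ (o :+ (o :+ (a :+ (b :+ c) :+ con 0)))))
      refl opt D (lazyCost us) (lazyCost (drop 1 us)) (lazyCost (drop 2 us)) (length us · D) T)
    where
    us = requests I
    opt≤ : ∀ k → opt ≤ k · D + lazyCost (drop k us)
    opt≤ k = ≤-trans (lower (schedule plan , plan⇒feasible plan , refl)) (cost≤ plan)
      where
      plan : Plan mode (initial I) 0# (k · D + lazyCost (drop k us))
      plan = greedyThenLazyPlan k (initial-describes I) zz inc (arrivals-≥0 I)

-- The adaptive input against a given online algorithm.

module Adversary (ℝ : CompleteOrderedField) (D : CompleteOrderedField.Carrier ℝ)
                 (0<D : CompleteOrderedField._<_ ℝ (CompleteOrderedField.0# ℝ) D)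
                 (mode : Service)
                 (A : Model.OnlineAlgorithm ℝ (twoPointLine ℝ D 0<D) zero mode) where
  open CompleteOrderedField ℝ
  open CompleteOrderedFieldProperties ℝ
  open FiniteMetricSpace (twoPointLine ℝ D 0<D)
  open Model ℝ (twoPointLine ℝ D 0<D) zero
  open ModelProperties ℝ (twoPointLine ℝ D 0<D) zero
  open TwoPointLine ℝ D 0<D
  open OnlineAlgorithm A
  open Reasoning

  feasible⇒timedFrom : ∀ {I S} → Feasible mode I S → TimedFrom 0# S
  feasible⇒timedFrom f = timedFrom (Feasible.times-≥0 f) (Feasible.times-sorted f)

  feasible⇒paysForTravel : ∀ {I S} → Feasible mode I S → PaysForTravel zero S
  feasible⇒paysForTravel {I} {S} f = paysForTravel mode {st = initial I} S ≡.refl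
    (Feasible.legal f) (feasible⇒timedFrom f) (λ q ())

  0≤feasibleCost : ∀ {I} → IsLowerBound (FeasibleCost mode I) 0#
  0≤feasibleCost (S , f , x≈cost) = ≤-trans (0≤cost S (feasible⇒paysForTravel f)) (inj₂ (sym x≈cost))

  -- The run of the algorithm itself shows that feasible costs exist, and they are bounded below by
  -- zero.
  optimum : ∀ I → ∃[ opt ] IsOPT mode I opt
  optimum I = infimum (FeasibleCost mode I) (ALG I , run I , feasible I , refl) (0# , 0≤feasibleCost)

  0≤opt : ∀ {I opt} → IsOPT mode I opt → 0# ≤ opt
  0≤opt (_ , approached) = ≮⇒≥ λ opt<0 →
    let x , x-feasible , x<0 = approached 0# opt<0 in ≤⇒≯ (0≤feasibleCost x-feasible) x<0

  -- The last of n alternating requests has been served by time τ.  The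
  -- distance from its location z to the current position is owed to the
  -- algorithm, so that it can be used in the triangle inequality for the
  -- next request.
  record Stage (δ : Carrier) (n : ℕ) : Set where
    field
      input      : Input
      z          : Point
      τ          : Carrier
      zigzag     : Zigzag zero (requests input) z
      increasing : Increasing (requests input)
      arrived    : All (λ q → arrival q ≤ τ) (requests input)
      labels     : All (λ l → l ℕ.< n) (map label (requests input))
      length≡n   : length (requests input) ≡ n
      0≤τ        : 0# ≤ τ
      paid       : n · D + τ + d z (end zero (actionsUpTo τ (run input)))
                     ≤ cost (actionsUpTo τ (run input)) + n · δ

  noRequests : Input
  noRequests = record { requests = [] ; distinct = [] ; arrivals-≥0 = [] }

  initialStage : ∀ δ → Stage δ 0
  initialStage δ = record
    { input = noRequests ; z = zero ; τ = 0# ; zigzag = [] ; increasing = [] ; arrived = []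
    ; labels = [] ; length≡n = ≡.refl ; 0≤τ = ≤-refl
    ; paid = ≤-from (travel≤cost 0# S (feasible⇒paysForTravel (feasible noRequests))
                                      (feasible⇒timedFrom (feasible noRequests)))
        (solve 2 (λ x C → con 0 :+ con 0 :+ x :+ C := C :+ con 0 :+ x) refl
          (d zero (end zero (actionsUpTo 0# S))) (cost (actionsUpTo 0# S)))
    }
    where S = run noRequests

  -- The next request comes strictly later than τ: what the algorithm does
  -- up to and including τ is then unaffected by it.
  nextStage : ∀ {δ n} → 0# < δ → Stage δ n → Stage δ (ℕ.suc n)
  nextStage {δ} {n} 0<δ stage = next (serveAfter mode (run I′) ≡.refl (Feasible.legal (feasible I′))
      (feasible⇒timedFrom (feasible I′)) (λ q ()) (∈-++⁺ʳ rs (here ≡.refl)) τ<s)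
    where
    open Stage stage renaming (input to I)
    rs = requests I
    s  = τ + δ
    -- The labels used so far are below `n`, so `n` is fresh.
    r  = request n s (other z)

    τ<s : τ < s
    τ<s = <-from 0<δ (sym (+-identityʳ s))

    labels-distinct : AllPairs _≢_ (map label (rs ∷ʳ r))
    labels-distinct rewrite map-++ label rs (r ∷ []) = AllPairs.++⁺ (distinct I) ([] ∷ [])
      (All.map (λ l<n → (λ { ≡.refl → ℕ.<-irrefl ≡.refl l<n }) ∷ []) labels)

    labels-bounded : All (λ l → l ℕ.< ℕ.suc n) (map label (rs ∷ʳ r))
    labels-bounded rewrite map-++ label rs (r ∷ []) =
      All.++⁺ (All.map ℕ.m≤n⇒m≤1+n labels) (ℕ.n<1+n n ∷ [])

    I′ : Input
    I′ = record
      { requests    = rs ∷ʳ r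
      ; distinct    = labels-distinct
      ; arrivals-≥0 = All.++⁺ (arrivals-≥0 I) (≤-trans 0≤τ (inj₁ τ<s) ∷ [])
      }

    same-past : requestsUpTo τ I ≡ requestsUpTo τ I′
    same-past = ≡.sym (≡.trans (filter-++ (λ q → arrival q ≤? τ) rs (r ∷ []))
      (≡.trans (≡.cong (requestsUpTo τ I ++_)
                 (filter-reject (λ q → arrival q ≤? τ) {r} {[]} λ s≤τ → ≤⇒≯ s≤τ τ<s))
               (++-identityʳ _)))

    pre : Schedule
    pre = actionsUpTo τ (run I′)

    paid-pre : n · D + τ + d z (end zero pre) ≤ cost pre + n · δ
    -- By causality the runs on `I` and `I′` agree up to `τ`, so the invariant transfers to the new
    -- run.
    paid-pre = ≡.subst (λ S → n · D + τ + d z (end zero S) ≤ cost S + n · δ) (causal I I′ τ same-past) paid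

    next : ∃[ τ′ ] s ≤ τ′ ×
             cost pre + (d (end zero pre) (other z) + τ′
               + d (other z) (end zero (actionsUpTo τ′ (run I′))))
             ≤ cost (actionsUpTo τ′ (run I′)) + s →
           Stage δ (ℕ.suc n)
    next (τ′ , s≤τ′ , served≤) = record
      { input      = I′
      ; z          = other z
      ; τ          = τ′
      ; zigzag     = zigzag-∷ʳ zigzag ≡.refl
      ; increasing = AllPairs.++⁺ increasing ([] ∷ [])
                       (All.map (λ q≤τ → ≤-<-trans q≤τ τ<s ∷ []) arrived)
      ; arrived    = All.++⁺ (All.map (λ q≤τ → ≤-trans q≤τ (≤-trans (inj₁ τ<s) s≤τ′)) arrived)
                             (s≤τ′ ∷ [])
      ; labels     = labels-bounded
      ; length≡n   = ≡.trans (length-++ rs) (≡.trans (ℕ.+-comm _ 1) (≡.cong ℕ.suc length≡n))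
      ; 0≤τ        = ≤-trans 0≤τ (≤-trans (inj₁ τ<s) s≤τ′)
      ; paid       = ≤-from
          -- The distance owed from `z` to `p` and the way from `p` to the new request together
          -- cover one crossing of length `D`. The gap between `τ` and `s` accounts for one more
          -- `δ`.
          (paid-pre +-≤ served≤ +-≤ triangle z p (other z) +-≤ inj₂ (reflexive (≡.sym (d-other z))))
          (solve 12 (λ D m τ′ x c k δ τ c₀ zp pz zz →
              D :+ m :+ τ′ :+ x :+ (c₀ :+ k :+ (c :+ (τ :+ δ) :+ (zp :+ pz :+ zz)))
              := c :+ (δ :+ k) :+ (m :+ τ :+ zp :+ (c₀ :+ (pz :+ τ′ :+ x) :+ (zz :+ D))))
            refl D (n · D) τ′ (d (other z) (end zero post)) (cost post) (n · δ) δ τ (cost pre)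
            (d z p) (d p (other z)) (d z (other z)))
      }
      where
      p    = end zero pre
      post = actionsUpTo τ′ (run I′)

  stage : ∀ {δ} → 0# < δ → ∀ n → Stage δ n
  stage 0<δ ℕ.zero    = initialStage _
  stage 0<δ (ℕ.suc n) = nextStage 0<δ (stage 0<δ n)

  -- Comparing the algorithm with the optimum.

  stageBound : ∀ {δ n} (st : Stage δ n) → n · D + Stage.τ st ≤ ALG (Stage.input st) + n · δ
  stageBound {δ} {n} st = ≤-from
    -- The owed distance and the cost of actions after `τ` are nonnegative and are dropped.
    (paid +-≤ d≥0 z e +-≤ cost-actionsUpTo≤ τ (run input) (feasible⇒paysForTravel (feasible input)))
    (solve 6 (λ m τ c a k x →
        m :+ τ :+ (c :+ k :+ (x :+ a)) := a :+ k :+ (m :+ τ :+ x :+ (con 0 :+ c)))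
      refl (n · D) τ (cost (actionsUpTo τ (run input))) (ALG input) (n · δ) (d z e))
    where
    open Stage st
    e = end zero (actionsUpTo τ (run input))

  -- Put `N = n · δ`. Replacing `ρ` by `3# - g` in the bound on the optimum loses three `N` and
  -- gains `g * (n · D)`, which is four `N`. The remaining `N` absorbs the fixed terms `ρ * (3 · D)`
  -- and three times `β`.
  stageBeyondRatio : ∀ {ρ g δ n} → 0# ≤ ρ → 0# < g → ρ + g ≈ 3# → δ + δ + (δ + δ) ≈ g * D → ∀ β →
                     ρ * (3 · D) + (β + (β + β)) < n · δ → (st : Stage δ n) →
                     ∀ {opt} → IsOPT mode (Stage.input st) opt → ρ * opt + β < ALG (Stage.input st)
  stageBeyondRatio {ρ} {g} {δ} {n} 0≤ρ 0<g ρ+g≈3 4δ≈gD β large st {opt} isOPT =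
    combineBounds 0≤ρ 0<g ρ+g≈3 opt≤ nD≤ 4N≈gnD large
    where
    open Stage st
    open CommutativeMonoidMult +-commutativeMonoid using (×-distrib-+)
    N = n · δ

    opt≤ : opt + (opt + opt) ≤ 3 · D + (ALG input + N)
    -- With `T = τ`, the quantity `n · D + τ` bounding the optimum from above is the one that bounds
    -- `ALG` from below.
    opt≤ = ≤-trans (3opt≤ isOPT zigzag increasing arrived 0≤τ)
      (≤-refl +-≤ ≡.subst (λ k → k · D + τ ≤ ALG input + N) (≡.sym length≡n) (stageBound st))

    nD≤ : n · D ≤ ALG input + N
    nD≤ = ≤-from (stageBound st +-≤ 0≤τ)
      (solve 3 (λ m τ b → m :+ (b :+ τ) := b :+ (m :+ τ :+ con 0)) refl (n · D) τ (ALG input + N))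

    4N≈gnD : N + N + (N + N) ≈ g * (n · D)
    4N≈gnD = begin-equality
      N + N + (N + N)           ≈⟨ +-cong (×-distrib-+ δ δ n) (×-distrib-+ δ δ n) ⟨
      n · (δ + δ) + n · (δ + δ) ≈⟨ ×-distrib-+ (δ + δ) (δ + δ) n ⟨
      n · (δ + δ + (δ + δ))     ≈⟨ ×-congʳ n 4δ≈gD ⟩
      n · (g * D)               ≈⟨ ×-comm-* n g D ⟨
      g * (n · D)               ∎

  beyondRatio : ∀ {ρ} → 0# ≤ ρ → ρ < 3# → ∀ β →
                ∃[ I ] ∃[ opt ] IsOPT mode I opt × ρ * opt + β < ALG I
  beyondRatio {ρ} 0≤ρ ρ<3 β =
    -- Halving twice yields `δ` as a quarter of `(3# - ρ) * D`; then `n` is taken large enough for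
    -- the fixed terms.
    let h , 0<h , h+h≈gD = half (*-pos (x<y⇒0<y-x ρ<3) 0<D)
        δ , 0<δ , δ+δ≈h  = half 0<h
        n , large        = archimedean 0<δ (ρ * (3 · D) + (β + (β + β)))
        st               = stage 0<δ n
        opt , isOPT      = optimum (Stage.input st)
    in Stage.input st , opt , isOPT ,
       stageBeyondRatio 0≤ρ (x<y⇒0<y-x ρ<3) (x+[y-x]≈y ρ 3#)
         (trans (+-cong δ+δ≈h δ+δ≈h) h+h≈gD) β large st isOPT

  unbounded : ∀ ρ → ρ < 3# → ∀ β → ∃[ I ] ∃[ opt ] IsOPT mode I opt × ρ * opt + β < ALG I
  unbounded ρ ρ<3 β with 0# ≤? ρ
  ... | yes 0≤ρ = beyondRatio 0≤ρ ρ<3 β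
  -- The optimum is nonnegative, so a negative ratio is weaker than the ratio zero.
  ... | no  0≰ρ =
    let I , opt , isOPT , 0·opt+β<alg = beyondRatio ≤-refl 0<3# β
    in I , opt , isOPT , ≤-<-trans (+-monoˡ-≤ β (begin
        ρ * opt  ≈⟨ *-comm ρ opt ⟩
        opt * ρ  ≤⟨ *-monoˡ-≤ (0≤opt isOPT) (inj₁ (≰⇒> 0≰ρ)) ⟩
        opt * 0# ≈⟨ *-comm opt 0# ⟩
        0# * opt ∎)) 0·opt+β<alg

theorem4p5 : (ℝ : CompleteOrderedField) →
    let open CompleteOrderedField ℝ in
    (D : Carrier) (0<D : 0# < D) →
    let open Model ℝ (twoPointLine ℝ D 0<D) zero in
    (mode : Service) (A : OnlineAlgorithm mode) →
    let open OnlineAlgorithm A in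
    (∀ ρ → Competitive A ρ → 3# ≤ ρ)
    × (∀ ρ → ρ < 3# → ∃[ I ] ∃[ opt ] IsOPT mode I opt × ρ * opt < ALG I)
    × (∀ ρ → ρ < 3# → ∀ β → ∃[ I ] ∃[ opt ] IsOPT mode I opt × ρ * opt + β < ALG I)
theorem4p5 ℝ D 0<D mode A = atLeast3 , strictlyBeyond , unbounded
  where
  open CompleteOrderedField ℝ
  open CompleteOrderedFieldProperties ℝ
  open Model ℝ (twoPointLine ℝ D 0<D) zero
  open OnlineAlgorithm A
  open Adversary ℝ D 0<D mode A

  strictlyBeyond : ∀ ρ → ρ < 3# → ∃[ I ] ∃[ opt ] IsOPT mode I opt × ρ * opt < ALG I
  strictlyBeyond ρ ρ<3 =
    let I , opt , isOPT , beyond = unbounded ρ ρ<3 0#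
    in I , opt , isOPT , ≤-<-trans (inj₂ (sym (+-identityʳ _))) beyond

  atLeast3 : ∀ ρ → Competitive A ρ → 3# ≤ ρ
  atLeast3 ρ competitive = ≮⇒≥ λ ρ<3 →
    let I , opt , isOPT , beyond = strictlyBeyond ρ ρ<3 in ≤⇒≯ (competitive I opt isOPT) beyond
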